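{- Let $G$ be a connected graph, $r\in V(G)$, $\mathcal{P}=\{F_1,\dots,F_t\}$ a partition of $E(G)$, and $g_1,\dots,g_t\in\mathbb{Z}_2^k$. For an edge $e\in F_j$ write $\mathrm{class}(e)=j$. The labeling $$\lambda(v)=\sum_{e\in P(r,v)} g_{\mathrm{class}(e)}\in\mathbb{Z}_2^k$$ is well defined (i.e. independent of the path $P(r,v)$ chosen from $r$ to $v$, for every $v$) if and only if for every cycle $C=(e_1,\dots,e_\ell)$ of $G$ $$\sum_{i=1}^{\ell} g_{\mathrm{class}(e_i)}=\mathbf{0}\in\mathbb{Z}_2^k .$$ Moreover, it suffices to verify this condition on the cycles of any cycle basis of $G$.
   Context: Graphs are finite, simple, connected and undirected. A cycle basis of $G$ is a set of cycles whose edge sets form a basis over $\mathbb{F}_2$ of the cycle space of $G$. -}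

module Defs where

open import Data.Bool using (if_then_else_)
open import Data.Fin using (Fin)
open import Data.Fin.Properties using (_≟_)
open import Data.Fin.Subset using (Subset; Nonempty) renaming (_∈_ to _∈ₛ_)
open import Data.List using (List; []; _∷_; map; foldr; length; tabulate)
open import Data.List.Membership.DecPropositional using (_∈?_)
open import Data.List.Relation.Unary.Unique.Propositional using (Unique)
open import Data.Nat using (ℕ; _≤_)
open import Data.Parity using (Parity; 0ℙ; 1ℙ) renaming (_+_ to _+ℙ_; _*_ to _*ℙ_)
open import Data.Product using (_×_; ∃; ∃-syntax; ∃!; proj₁)
open import Data.Sum using (_⊎_)
open import Data.Vec as Vec using (Vec)
open import Relation.Binary.PropositionalEquality using (_≡_)
open import Relation.Nullary using (¬_; does)

-- The library's Parity, with its ring operations, serves as the field ℤ₂.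
ℤ₂^_ : ℕ → Set
ℤ₂^ k = Vec Parity k

𝟎 : ∀ {k} → ℤ₂^ k
𝟎 = Vec.replicate _ 0ℙ

infixl 6 _⊕_
_⊕_ : ∀ {k} → ℤ₂^ k → ℤ₂^ k → ℤ₂^ k
_⊕_ = Vec.zipWith _+ℙ_

infixr 7 _•_
_•_ : ∀ {k} → Parity → ℤ₂^ k → ℤ₂^ k
c • x = Vec.map (c *ℙ_) x

∑ : ∀ {k} → List (ℤ₂^ k) → ℤ₂^ k
∑ = foldr _⊕_ 𝟎

linComb : ∀ {k d} → (Fin d → Parity) → (Fin d → ℤ₂^ k) → ℤ₂^ k
linComb c b = ∑ (tabulate λ i → c i • b i)

LinearlyIndependent : ∀ {k d} → (Fin d → ℤ₂^ k) → Set
LinearlyIndependent b = ∀ c → linComb c b ≡ 𝟎 → ∀ i → c i ≡ 0ℙ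

-- The span of a possibly infinite family: all finite linear combinations.
Span : ∀ {k} {I : Set} → (I → ℤ₂^ k) → ℤ₂^ k → Set
Span {I = I} x y = ∃[ d ] ∃ λ (ι : Fin d → I) → ∃[ c ] linComb c (λ i → x (ι i)) ≡ y

record IsBasis {k d} (W : ℤ₂^ k → Set) (b : Fin d → ℤ₂^ k) : Set where
  field
    inside      : ∀ i → W (b i)
    independent : LinearlyIndependent b
    spanning    : ∀ {y} → W y → Span b y

-- A finite simple graph with V(G) = Fin #V and E(G) = Fin #E;
-- Joins e u v says that {u , v} is the set of ends of e.
record Graph : Set where
  field
    #V #E : ℕ
    end₁ end₂ : Fin #E → Fin #V

  V : Set
  V = Fin #V

  E : Set
  E = Fin #E

  Joins : E → V → V → Set
  Joins e u v = (end₁ e ≡ u × end₂ e ≡ v) ⊎ (end₁ e ≡ v × end₂ e ≡ u)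

  field
    loopless : ∀ {e v} → ¬ Joins e v v
    simple   : ∀ {e f u v} → Joins e u v → Joins f u v → e ≡ f

module _ (G : Graph) where
  open Graph G

  data Walk : V → V → Set where
    nil  : ∀ {v} → Walk v v
    step : ∀ {u v w} (e : E) → Joins e u v → Walk v w → Walk u w

module _ {G : Graph} where
  open Graph G

  edges : ∀ {u v} → Walk G u v → List E
  edges nil          = []
  edges (step e _ p) = e ∷ edges p

  -- All vertices of the walk, in order, except the final one.
  initials : ∀ {u v} → Walk G u v → List V
  initials nil              = []
  initials {u} (step _ _ p) = u ∷ initials p

  vertices : ∀ {u v} → Walk G u v → List V
  vertices {u} nil          = u ∷ []
  vertices {u} (step _ _ p) = u ∷ vertices p

module _ (G : Graph) where
  open Graph G

  record Path (u v : V) : Set where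
    field
      walk     : Walk G u v
      distinct : Unique (vertices walk)

  Connected : Set
  Connected = ∀ u v → Path u v

  -- A closed walk v₀ e₁ v₁ … e_ℓ v_ℓ = v₀ with ℓ ≥ 3 and v₀ , … , v_{ℓ-1} distinct.
  record Cycle : Set where
    field
      base     : V
      walk     : Walk G base base
      long     : 3 ≤ length (edges walk)
      distinct : Unique (initials walk)

  record Partition (t : ℕ) : Set where
    field
      F        : Fin t → Subset #E
      nonempty : ∀ j → Nonempty (F j)
      unique   : ∀ e → ∃! _≡_ (λ j → e ∈ₛ F j)

    class : E → Fin t
    class e = proj₁ (unique e)

module _ {G : Graph} where
  open Graph G

  pathEdges : ∀ {u v} → Path G u v → List E
  pathEdges P = edges (Path.walk P)

  cycleEdges : Cycle G → List E
  cycleEdges C = edges (Cycle.walk C)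

  -- The characteristic vector of the edge set of a cycle, in ℤ₂^E(G).
  edgeSet : Cycle G → ℤ₂^ #E
  edgeSet C = Vec.tabulate λ e → if does (_∈?_ _≟_ e (cycleEdges C)) then 1ℙ else 0ℙ

module _ (G : Graph) where
  open Graph G

  CycleSpace : ℤ₂^ #E → Set
  CycleSpace = Span (edgeSet {G})

  IsCycleBasis : ∀ {d} → (Fin d → Cycle G) → Set
  IsCycleBasis B = IsBasis CycleSpace (λ i → edgeSet (B i))

module _ {G : Graph} {t k : ℕ} (𝒫 : Partition G t) (g : Fin t → ℤ₂^ k) where
  open Graph G
  open Partition 𝒫

  labelSum : List E → ℤ₂^ k
  labelSum es = ∑ (map (λ e → g (class e)) es)

  WellDefined : V → Set
  WellDefined r = ∀ v (P Q : Path G r v) → labelSum (pathEdges P) ≡ labelSum (pathEdges Q)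

  ZeroOn : Cycle G → Set
  ZeroOn C = labelSum (cycleEdges C) ≡ 𝟎

{-# OPTIONS --safe #-}

-- A well-defined labeling is a potential: for an edge e = uv and a path p from
-- v to the root, either e extends p to a path from u, or u lies on p and e
-- extends the part of p after u to a path from v.  So the labels of u and v
-- differ by the weight of e, and the weights of a closed walk telescope to 𝟎.
-- Conversely, if all cycles have weight 𝟎, erasing loops turns a walk into a
-- path of the same weight, and a closed walk composed of two paths from r into
-- the trivial path.  For cycle bases: the weight of a cycle is the value of a
-- linear map ℤ₂^E → ℤ₂^k at its edge set, since a cycle has no repeated edge.
module Submission where

open import Defs
open import Algebra.Bundles using (AbelianGroup)
import Algebra.Properties.AbelianGroup as AbelianGroupProperties
import Algebra.Properties.CommutativeSemigroup as CommutativeSemigroupProperties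
open import Data.Bool using (if_then_else_)
open import Data.Empty using (⊥-elim)
open import Data.Fin using (Fin; zero; suc)
open import Data.Fin.Properties using (_≟_)
open import Data.List using (List; []; _∷_; _∷ʳ_; _++_; map)
open import Data.List.Membership.Propositional using (_∈_; _∉_)
open import Data.List.Membership.DecPropositional using (_∈?_)
open import Data.List.Properties using (++-assoc)
open import Data.List.Relation.Binary.Permutation.Propositional
  using (_↭_; ↭-refl; ↭-reflexive; ↭-sym; ↭-trans; prep; ↭⇒↭ₛ)
open import Data.List.Relation.Binary.Permutation.Propositional.Properties
  using (shift; ∷↭∷ʳ)
import Data.List.Relation.Binary.Permutation.Setoid.Properties as Permutationₛ
open import Data.List.Relation.Unary.All using ([]; _∷_)
open import Data.List.Relation.Unary.All.Properties
  using (¬Any⇒All¬; ++⁻ˡ)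
open import Data.List.Relation.Unary.AllPairs using ([]; _∷_)
open import Data.List.Relation.Unary.Any using (here; there)
open import Data.List.Relation.Unary.Any.Properties using (++⁺ʳ)
open import Data.List.Relation.Unary.Unique.Propositional using (Unique)
open import Data.List.Relation.Unary.Unique.Propositional.Properties
  using (Unique[x∷xs]⇒x∉xs)
open import Data.Nat using (ℕ; z≤n; s≤s)
open import Data.Parity using (Parity; 0ℙ; 1ℙ) renaming (_+_ to _+ℙ_)
import Data.Parity.Properties as Parity
open import Data.Product using (_×_; _,_; ∃-syntax)
open import Data.Sum using (_⊎_; inj₁; inj₂; swap)
open import Data.Vec as Vec using ([]; _∷_)
import Data.Vec.Properties as Vec
open import Function using (_∘_)
open import Function.Bundles using (_⇔_; mk⇔)
open import Level using (0ℓ)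
open import Relation.Binary.PropositionalEquality
  using (_≡_; _≗_; refl; sym; trans; cong; cong₂; subst; setoid; isEquivalence;
         module ≡-Reasoning)
open import Relation.Nullary using (does; yes; no)
open ≡-Reasoning

-- Lists without repetitions

module _ {A : Set} where

  Unique-resp-↭ : ∀ {xs ys : List A} → xs ↭ ys → Unique xs → Unique ys
  Unique-resp-↭ p = Permutationₛ.Unique-resp-↭ (setoid A) (↭⇒↭ₛ p)

  Unique-++⁻ˡ : ∀ xs {ys : List A} → Unique (xs ++ ys) → Unique xs
  Unique-++⁻ˡ []       _        = []
  Unique-++⁻ˡ (x ∷ xs) (x∉ ∷ u) = ++⁻ˡ xs x∉ ∷ Unique-++⁻ˡ xs u

  Unique-++⁻ʳ : ∀ xs {ys : List A} → Unique (xs ++ ys) → Unique ys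
  Unique-++⁻ʳ []       u       = u
  Unique-++⁻ʳ (_ ∷ xs) (_ ∷ u) = Unique-++⁻ʳ xs u

  ∉⇒Unique-∷ : ∀ {x : A} {xs} → x ∉ xs → Unique xs → Unique (x ∷ xs)
  ∉⇒Unique-∷ x∉ u = ¬Any⇒All¬ _ x∉ ∷ u

-- The group ℤ₂^k

⊕-self : ∀ {k} (x : ℤ₂^ k) → x ⊕ x ≡ 𝟎
⊕-self []      = refl
⊕-self (a ∷ x) = cong₂ _∷_ (Parity.p+p≡0ℙ a) (⊕-self x)

⊕-abelianGroup : ℕ → AbelianGroup 0ℓ 0ℓ
⊕-abelianGroup k = record
  { Carrier = ℤ₂^ k
  ; _≈_     = _≡_
  ; _∙_     = _⊕_
  ; ε       = 𝟎
  ; _⁻¹     = λ x → x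
  ; isAbelianGroup = record
    { isGroup = record
      { isMonoid = record
        { isSemigroup = record
          { isMagma = record { isEquivalence = isEquivalence ; ∙-cong = cong₂ _⊕_ }
          ; assoc   = Vec.zipWith-assoc Parity.+-assoc
          }
        ; identity = Vec.zipWith-identityˡ Parity.+-identityˡ
                   , Vec.zipWith-identityʳ Parity.+-identityʳ
        }
      ; inverse = ⊕-self , ⊕-self
      ; ⁻¹-cong = λ eq → eq
      }
    ; comm = Vec.zipWith-comm Parity.+-comm
    }
  }

module _ {k : ℕ} where
  open AbelianGroup (⊕-abelianGroup k) public
    using () renaming (assoc to ⊕-assoc; comm to ⊕-comm;
                       identityˡ to ⊕-identityˡ; identityʳ to ⊕-identityʳ)
  -- As inversion is the identity map, these laws read `x ⊕ (x ⊕ y) ≡ y`, `x ⊕ y ≡ 𝟎 → x ≡ y` and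
  -- `x ⊕ y ≡ y → x ≡ 𝟎`.
  open AbelianGroupProperties (⊕-abelianGroup k) public
    using () renaming (\\-leftDividesʳ to ⊕-cancel; inverseˡ-unique to ⊕≡𝟎⇒≡;
                       identityˡ-unique to ⊕≡ʳ⇒≡𝟎)
  open CommutativeSemigroupProperties
    (AbelianGroup.commutativeSemigroup (⊕-abelianGroup k)) public
    using () renaming (interchange to ⊕-interchange)

0ℙ-• : ∀ {k} (x : ℤ₂^ k) → 0ℙ • x ≡ 𝟎
0ℙ-• x = Vec.map-const x 0ℙ

1ℙ-• : ∀ {k} (x : ℤ₂^ k) → 1ℙ • x ≡ x
1ℙ-• = Vec.map-id

•-𝟎 : ∀ {k} a → a • 𝟎 {k} ≡ 𝟎
•-𝟎 0ℙ = 0ℙ-• 𝟎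
•-𝟎 1ℙ = 1ℙ-• 𝟎

•-distribʳ : ∀ {k} a b (x : ℤ₂^ k) → (a +ℙ b) • x ≡ a • x ⊕ b • x
•-distribʳ a b []      = refl
•-distribʳ a b (c ∷ x) = cong₂ _∷_ (Parity.*-distribʳ-+ c a b) (•-distribʳ a b x)

linComb-cong : ∀ {k d} (c : Fin d → Parity) {x y : Fin d → ℤ₂^ k} →
  x ≗ y → linComb c x ≡ linComb c y
linComb-cong {d = ℕ.zero}  c x≗y = refl
linComb-cong {d = ℕ.suc d} c x≗y =
  cong₂ _⊕_ (cong (c zero •_) (x≗y zero)) (linComb-cong (c ∘ suc) (x≗y ∘ suc))

linComb-𝟎 : ∀ {k d} (c : Fin d → Parity) → linComb c (λ _ → 𝟎 {k}) ≡ 𝟎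
linComb-𝟎 {d = ℕ.zero}  c = refl
linComb-𝟎 {d = ℕ.suc d} c =
  trans (cong₂ _⊕_ (•-𝟎 (c zero)) (linComb-𝟎 (c ∘ suc))) (⊕-identityˡ 𝟎)

-- The linear extension of a map given on the standard basis

extend : ∀ {n k} → (Fin n → ℤ₂^ k) → ℤ₂^ n → ℤ₂^ k
extend h x = linComb (Vec.lookup x) h

module _ {k : ℕ} where

  extend-𝟎 : ∀ {n} (h : Fin n → ℤ₂^ k) → extend h 𝟎 ≡ 𝟎
  extend-𝟎 {ℕ.zero}  h = refl
  extend-𝟎 {ℕ.suc n} h =
    trans (cong₂ _⊕_ (0ℙ-• (h zero)) (extend-𝟎 (h ∘ suc))) (⊕-identityˡ 𝟎)

  extend-⊕ : ∀ {n} (h : Fin n → ℤ₂^ k) x y → extend h (x ⊕ y) ≡ extend h x ⊕ extend h y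
  extend-⊕ h []      []      = sym (⊕-identityˡ 𝟎)
  extend-⊕ h (a ∷ x) (b ∷ y) =
    trans (cong₂ _⊕_ (•-distribʳ a b (h zero)) (extend-⊕ (h ∘ suc) x y))
          (⊕-interchange (a • h zero) (b • h zero) _ _)

  extend-• : ∀ {n} (h : Fin n → ℤ₂^ k) a x → extend h (a • x) ≡ a • extend h x
  extend-• h 0ℙ x = begin
    extend h (0ℙ • x)  ≡⟨ cong (extend h) (0ℙ-• x) ⟩
    extend h 𝟎         ≡⟨ extend-𝟎 h ⟩
    𝟎                  ≡⟨ 0ℙ-• (extend h x) ⟨
    0ℙ • extend h x    ∎
  extend-• h 1ℙ x = trans (cong (extend h) (1ℙ-• x)) (sym (1ℙ-• (extend h x)))

  extend-linComb : ∀ {n d} (h : Fin n → ℤ₂^ k) (c : Fin d → Parity) x →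
    extend h (linComb c x) ≡ linComb c (extend h ∘ x)
  extend-linComb {d = ℕ.zero}  h c x = extend-𝟎 h
  extend-linComb {d = ℕ.suc d} h c x =
    trans (extend-⊕ h (c zero • x zero) _)
          (cong₂ _⊕_ (extend-• h (c zero) (x zero)) (extend-linComb h (c ∘ suc) (x ∘ suc)))

  -- The kernel of a linear map is a subspace, so it contains the span of any family inside it. This
  -- carries the zero condition from a cycle basis to all cycles.
  extend-span : ∀ {n} {I : Set} (h : Fin n → ℤ₂^ k) (x : I → ℤ₂^ n) {y} → (∀ i → extend h (x i) ≡ 𝟎) →
    Span x y → extend h y ≡ 𝟎
  extend-span h x x-zero (_ , ι , c , refl) = begin
    extend h (linComb c (x ∘ ι))   ≡⟨ extend-linComb h c (x ∘ ι) ⟩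
    linComb c (extend h ∘ x ∘ ι)   ≡⟨ linComb-cong c (x-zero ∘ ι) ⟩
    linComb c (λ _ → 𝟎)            ≡⟨ linComb-𝟎 c ⟩
    𝟎                              ∎

span-member : ∀ {k} {I : Set} (x : I → ℤ₂^ k) i → Span x (x i)
span-member x i = 1 , (λ _ → i) , (λ _ → 1ℙ) , trans (⊕-identityʳ _) (1ℙ-• (x i))

-- Characteristic vectors

unit : ∀ {n} → Fin n → ℤ₂^ n
unit i = Vec.tabulate λ j → if does (j ≟ i) then 1ℙ else 0ℙ

-- Spelled like `edgeSet`, so that `edgeSet C` is `indicator (cycleEdges C)` by definition.
indicator : ∀ {n} → List (Fin n) → ℤ₂^ n
indicator is = Vec.tabulate λ j → if does (_∈?_ _≟_ j is) then 1ℙ else 0ℙ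

tabulate-0ℙ : ∀ n → Vec.tabulate {n = n} (λ _ → 0ℙ) ≡ 𝟎
tabulate-0ℙ ℕ.zero    = refl
tabulate-0ℙ (ℕ.suc n) = cong (0ℙ ∷_) (tabulate-0ℙ n)

tabulate-⊕ : ∀ {n} (f g : Fin n → Parity) →
  Vec.tabulate (λ i → f i +ℙ g i) ≡ Vec.tabulate f ⊕ Vec.tabulate g
tabulate-⊕ {ℕ.zero}  f g = refl
tabulate-⊕ {ℕ.suc n} f g = cong (f zero +ℙ g zero ∷_) (tabulate-⊕ (f ∘ suc) (g ∘ suc))

-- If `i` occurred in `is`, the two ones at position `i` would cancel on the right but not on the
-- left.
indicator-∷ : ∀ {n} {i : Fin n} {is} → i ∉ is → indicator (i ∷ is) ≡ unit i ⊕ indicator is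
indicator-∷ {i = i} {is} i∉ = trans (Vec.tabulate-cong pointwise) (tabulate-⊕ _ _)
  where
  pointwise : ∀ j → (if does (_∈?_ _≟_ j (i ∷ is)) then 1ℙ else 0ℙ) ≡
    (if does (j ≟ i) then 1ℙ else 0ℙ) +ℙ (if does (_∈?_ _≟_ j is) then 1ℙ else 0ℙ)
  pointwise j with j ≟ i | _∈?_ _≟_ j is
  ... | yes refl | yes i∈ = ⊥-elim (i∉ i∈)
  ... | yes refl | no  _  = refl
  ... | no  _    | yes _  = refl
  ... | no  _    | no  _  = refl

module _ {k : ℕ} where

  extend-unit : ∀ {n} (h : Fin n → ℤ₂^ k) i → extend h (unit i) ≡ h i
  extend-unit {ℕ.suc n} h zero = begin
    1ℙ • h zero ⊕ extend (h ∘ suc) (Vec.tabulate λ _ → 0ℙ)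
      ≡⟨ cong₂ _⊕_ (1ℙ-• (h zero)) (cong (extend (h ∘ suc)) (tabulate-0ℙ n)) ⟩
    h zero ⊕ extend (h ∘ suc) 𝟎  ≡⟨ cong (h zero ⊕_) (extend-𝟎 (h ∘ suc)) ⟩
    h zero ⊕ 𝟎                   ≡⟨ ⊕-identityʳ (h zero) ⟩
    h zero                       ∎
  extend-unit h (suc i) =
    trans (cong₂ _⊕_ (0ℙ-• (h zero)) (extend-unit (h ∘ suc) i)) (⊕-identityˡ _)

  -- The sum counts multiplicities and the indicator does not; `Unique` makes them agree.
  extend-indicator : ∀ {n} (h : Fin n → ℤ₂^ k) {is} → Unique is →
    extend h (indicator is) ≡ ∑ (map h is)
  extend-indicator {n} h {[]} [] = trans (cong (extend h) (tabulate-0ℙ n)) (extend-𝟎 h)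
  extend-indicator h {i ∷ is} u@(_ ∷ v) = begin
    extend h (indicator (i ∷ is))
      ≡⟨ cong (extend h) (indicator-∷ (Unique[x∷xs]⇒x∉xs u)) ⟩
    extend h (unit i ⊕ indicator is)             ≡⟨ extend-⊕ h (unit i) _ ⟩
    extend h (unit i) ⊕ extend h (indicator is)
      ≡⟨ cong₂ _⊕_ (extend-unit h i) (extend-indicator h v) ⟩
    h i ⊕ ∑ (map h is)                           ∎

-- Walks

module _ {G : Graph} where
  open Graph G

  Joins-ends : ∀ {e u v x y} → Joins e u v → Joins e x y → (x ≡ u × y ≡ v) ⊎ (x ≡ v × y ≡ u)
  Joins-ends (inj₁ (refl , refl)) (inj₁ (refl , refl)) = inj₁ (refl , refl)
  Joins-ends (inj₁ (refl , refl)) (inj₂ (refl , refl)) = inj₂ (refl , refl)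
  Joins-ends (inj₂ (refl , refl)) (inj₁ (refl , refl)) = inj₂ (refl , refl)
  Joins-ends (inj₂ (refl , refl)) (inj₂ (refl , refl)) = inj₁ (refl , refl)

  infixr 5 _++ʷ_
  _++ʷ_ : ∀ {u v w} → Walk G u v → Walk G v w → Walk G u w
  nil        ++ʷ q = q
  step e j p ++ʷ q = step e j (p ++ʷ q)

  reverseʷ : ∀ {u v} → Walk G u v → Walk G v u
  reverseʷ nil          = nil
  reverseʷ (step e j p) = reverseʷ p ++ʷ step e (swap j) nil

  vertices-++ʷ : ∀ {u v w} (p : Walk G u v) (q : Walk G v w) →
    vertices (p ++ʷ q) ≡ initials p ++ vertices q
  vertices-++ʷ nil              q = refl
  vertices-++ʷ {u} (step e j p) q = cong (u ∷_) (vertices-++ʷ p q)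

  vertices-∷ʳ : ∀ {u v} (p : Walk G u v) → vertices p ≡ initials p ∷ʳ v
  vertices-∷ʳ nil              = refl
  vertices-∷ʳ {u} (step e j p) = cong (u ∷_) (vertices-∷ʳ p)

  -- A permutation is enough to transfer distinctness of the vertices to the reversed walk.
  vertices-reverseʷ : ∀ {u v} (p : Walk G u v) → vertices (reverseʷ p) ↭ vertices p
  vertices-reverseʷ nil = ↭-refl
  vertices-reverseʷ {u} (step {v = x} e j p) =
    ↭-trans (↭-reflexive (begin
      vertices (reverseʷ p ++ʷ step e (swap j) nil)  ≡⟨ vertices-++ʷ (reverseʷ p) _ ⟩
      initials (reverseʷ p) ++ x ∷ u ∷ []            ≡⟨ ++-assoc (initials (reverseʷ p)) _ _ ⟨
      (initials (reverseʷ p) ∷ʳ x) ∷ʳ u              ≡⟨ cong (_∷ʳ u) (vertices-∷ʳ (reverseʷ p)) ⟨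
      vertices (reverseʷ p) ∷ʳ u                     ∎))
    (↭-trans (↭-sym (∷↭∷ʳ u _)) (prep u (vertices-reverseʷ p)))

  source∈vertices : ∀ {u v} (p : Walk G u v) → u ∈ vertices p
  source∈vertices nil          = here refl
  source∈vertices (step _ _ _) = here refl

  -- Applied contrapositively: a walk that misses an end of `e` does not use `e`. With `swap` it
  -- covers the other end.
  end∈vertices : ∀ {e x y u v} → Joins e x y → (p : Walk G u v) → e ∈ edges p → x ∈ vertices p
  end∈vertices i (step e j p) (here refl) with Joins-ends j i
  ... | inj₁ (refl , _) = here refl
  ... | inj₂ (refl , _) = there (source∈vertices p)
  end∈vertices i (step e j p) (there e∈) = there (end∈vertices i p e∈)

  split : ∀ {u v x} (p : Walk G u v) → x ∈ vertices p →
    ∃[ q ] ∃[ q′ ] p ≡ _++ʷ_ {u} {x} {v} q q′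
  split nil          (here refl) = nil , nil , refl
  split (step e j p) (here refl) = nil , step e j p , refl
  split (step e j p) (there x∈)  with split p x∈
  ... | q , q′ , refl = step e j q , q′ , refl

  Unique-suffix : ∀ {u v w} (p : Walk G u v) (q : Walk G v w) →
    Unique (vertices (p ++ʷ q)) → Unique (vertices q)
  Unique-suffix p q = Unique-++⁻ʳ (initials p) ∘ subst Unique (vertices-++ʷ p q)

  -- The list `v ∷ initials p` is the `initials` of the closed walk made of an edge from `v` to `u`
  -- and `p`. Removing that edge moves `v` from the front of the list to its back.
  Unique-open : ∀ {u v} (p : Walk G u v) → Unique (v ∷ initials p) → Unique (vertices p)
  Unique-open p =
    Unique-resp-↭ (↭-trans (∷↭∷ʳ _ _) (↭-reflexive (sym (vertices-∷ʳ p))))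

  -- The conclusion has the form that a cycle requires once an edge from `v` to `u` is put before
  -- `p`.
  Unique-prefix : ∀ {u v w} (p : Walk G u v) (q : Walk G v w) →
    Unique (vertices (p ++ʷ q)) → Unique (v ∷ initials p)
  Unique-prefix {v = v} p q u =
    Unique-++⁻ˡ (v ∷ initials p)
      (Unique-resp-↭ (shift v (initials p) (rest q))
        (subst Unique (trans (vertices-++ʷ p q) (cong (initials p ++_) (vertices-∷ q))) u))
    where
    rest : ∀ {v w} → Walk G v w → List V
    rest nil          = []
    rest (step _ _ q) = vertices q

    vertices-∷ : ∀ {v w} (q : Walk G v w) → vertices q ≡ v ∷ rest q
    vertices-∷ nil          = refl
    vertices-∷ (step _ _ _) = refl

  -- A second use of the first edge would bring the start of the walk back among the later vertices.
  edges-unique : ∀ {u v} (p : Walk G u v) → Unique (vertices p) → Unique (edges p)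
  edges-unique nil          _         = []
  edges-unique (step e j p) d@(_ ∷ d′) =
    ∉⇒Unique-∷ (Unique[x∷xs]⇒x∉xs d ∘ end∈vertices j p) (edges-unique p d′)

  -- Without its first edge `e` the cycle is a path `q`. If `e` recurs after the first edge of `q`,
  -- the second vertex of the cycle recurs. If `e` is the first edge of `q`, the third vertex equals
  -- the base, which is impossible since three edges make both of them `initials`.
  cycleEdges-unique : (C : Cycle G) → Unique (cycleEdges C)
  cycleEdges-unique record { walk = step e i (step f j (step g l p)) ; distinct = d } =
    ∉⇒Unique-∷ e∉ (edges-unique q d′)
    where
    q  = step f j (step g l p)
    d′ = Unique-open q d
    e∉ : e ∉ edges q
    e∉ (there e∈) = Unique[x∷xs]⇒x∉xs d′ (end∈vertices (swap i) (step g l p) e∈)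
    e∉ (here refl) with Joins-ends i j
    ... | inj₁ (refl , _) = loopless i
    ... | inj₂ (_ , refl) = Unique[x∷xs]⇒x∉xs d (there (here refl))
  cycleEdges-unique record { walk = nil ; long = () }
  cycleEdges-unique record { walk = step _ _ nil ; long = s≤s () }
  cycleEdges-unique record { walk = step _ _ (step _ _ nil) ; long = s≤s (s≤s ()) }

-- Weights of walks

module _ {G : Graph} {k : ℕ} (h : Graph.E G → ℤ₂^ k) where
  open Graph G

  weight : ∀ {u v} → Walk G u v → ℤ₂^ k
  weight p = ∑ (map h (edges p))

  weight-++ʷ : ∀ {u v w} (p : Walk G u v) (q : Walk G v w) →
    weight (p ++ʷ q) ≡ weight p ⊕ weight q
  weight-++ʷ nil          q = sym (⊕-identityˡ (weight q))
  weight-++ʷ (step e _ p) q =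
    trans (cong (h e ⊕_) (weight-++ʷ p q)) (sym (⊕-assoc (h e) (weight p) (weight q)))

  weight-reverseʷ : ∀ {u v} (p : Walk G u v) → weight (reverseʷ p) ≡ weight p
  weight-reverseʷ nil          = refl
  weight-reverseʷ (step e j p) = begin
    weight (reverseʷ p ++ʷ step e (swap j) nil)  ≡⟨ weight-++ʷ (reverseʷ p) _ ⟩
    weight (reverseʷ p) ⊕ (h e ⊕ 𝟎)              ≡⟨ cong₂ _⊕_ (weight-reverseʷ p) (⊕-identityʳ (h e)) ⟩
    weight p ⊕ h e                               ≡⟨ ⊕-comm (weight p) (h e) ⟩
    h e ⊕ weight p                               ∎

  -- Potentials

  module _ {φ : V → ℤ₂^ k} (φ-edge : ∀ {e u v} → Joins e u v → h e ⊕ φ v ≡ φ u) where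

    telescope : ∀ {u v} (p : Walk G u v) → weight p ⊕ φ v ≡ φ u
    telescope {v = v} nil = ⊕-identityˡ (φ v)
    telescope (step e j p) = begin
      (h e ⊕ weight p) ⊕ φ _  ≡⟨ ⊕-assoc (h e) (weight p) _ ⟩
      h e ⊕ (weight p ⊕ φ _)  ≡⟨ cong (h e ⊕_) (telescope p) ⟩
      h e ⊕ φ _               ≡⟨ φ-edge j ⟩
      φ _                     ∎

    closed-walk-zero : ∀ {v} (p : Walk G v v) → weight p ≡ 𝟎
    closed-walk-zero p = ⊕≡ʳ⇒≡𝟎 (weight p) _ (telescope p)

  module _ {r : V} (connected : ∀ v → Path G v r)
    (independent : ∀ {v} (P Q : Path G v r) → weight (Path.walk P) ≡ weight (Path.walk Q)) where

    -- The chosen paths lead to the root, so that an edge at `v` is prepended by `step`.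
    potential : V → ℤ₂^ k
    potential v = weight (Path.walk (connected v))

    potential-edge : ∀ {e u v} → Joins e u v → h e ⊕ potential v ≡ potential u
    potential-edge {e} {u} {v} j with connected v
    ... | record { walk = p ; distinct = d } with _∈?_ _≟_ u (vertices p)
    ...   | no  u∉ =
      independent (record { walk = step e j p ; distinct = ∉⇒Unique-∷ u∉ d }) (connected u)
    ...   | yes u∈ with split p u∈
    -- An empty first part means that `u` and `v` coincide.
    ...     | nil , _ , _ = ⊥-elim (loopless j)
    -- The part `q′` runs from `u` to `r` and avoids `v`, the first vertex of the path `p`. Hence
    -- `e` followed by `q′` is a second path from `v`, with the same weight as `p`.
    ...     | step f i q , q′ , refl = begin
      h e ⊕ weight p           ≡⟨ cong (h e ⊕_) (independent (record { walk = p ; distinct = d }) detour) ⟩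
      h e ⊕ (h e ⊕ weight q′)  ≡⟨ ⊕-cancel (h e) (weight q′) ⟩
      weight q′                ≡⟨ independent (record { walk = q′ ; distinct = d′ }) (connected u) ⟩
      potential u              ∎
      where
      d′ = Unique-suffix (step f i q) q′ d
      v∉ : v ∉ vertices q′
      v∉ = Unique[x∷xs]⇒x∉xs d ∘ subst (v ∈_) (sym (vertices-++ʷ q q′)) ∘ ++⁺ʳ (initials q)
      detour : Path G v r
      detour = record { walk = step e (swap j) q′ ; distinct = ∉⇒Unique-∷ v∉ d′ }

  -- Loop erasure

  module _ (cycle-zero : (C : Cycle G) → weight (Cycle.walk C) ≡ 𝟎) where

    -- With at least two edges, `p` is closed by `e` to a cycle. A single edge must be `e` itself,
    -- as the graph is simple, and is then counted twice; an empty `p` would make `e` a loop.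
    closing-zero : ∀ {e u v} → Joins e u v → (p : Walk G v u) → Unique (u ∷ initials p) →
      h e ⊕ weight p ≡ 𝟎
    closing-zero     i nil          _ = ⊥-elim (loopless i)
    closing-zero {e} i (step f j nil) _ with refl ← simple i (swap j) = ⊕-cancel (h e) 𝟎
    closing-zero {e} i p@(step _ _ (step _ _ _)) d = cycle-zero record
      { walk = step e i p ; long = s≤s (s≤s (s≤s z≤n)) ; distinct = d }

    -- Loops are erased from the back of the walk. If the new vertex `u` already lies on the path
    -- `q`, then `e` and the part `q₁` of `q` up to `u` close up with weight `𝟎` and are dropped.
    erase-loops : ∀ {u v} (p : Walk G u v) →
      ∃[ q ] Unique (vertices {u = u} {v} q) × weight q ≡ weight p
    erase-loops nil = nil , [] ∷ [] , refl
    erase-loops {u} (step e j p) with erase-loops p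
    ... | q , d , eq with _∈?_ _≟_ u (vertices q)
    ...   | no  u∉ = step e j q , ∉⇒Unique-∷ u∉ d , cong (h e ⊕_) eq
    ...   | yes u∈ with split q u∈
    ...     | q₁ , q₂ , refl = q₂ , Unique-suffix q₁ q₂ d , (begin
      weight q₂                       ≡⟨ ⊕-identityˡ (weight q₂) ⟨
      𝟎 ⊕ weight q₂                   ≡⟨ cong (_⊕ weight q₂) (closing-zero j q₁ (Unique-prefix q₁ q₂ d)) ⟨
      (h e ⊕ weight q₁) ⊕ weight q₂   ≡⟨ ⊕-assoc (h e) (weight q₁) (weight q₂) ⟩
      h e ⊕ (weight q₁ ⊕ weight q₂)   ≡⟨ cong (h e ⊕_) (weight-++ʷ q₁ q₂) ⟨
      h e ⊕ weight (q₁ ++ʷ q₂)        ≡⟨ cong (h e ⊕_) eq ⟩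
      h e ⊕ weight p                  ∎)

    cycle-zero⇒closed-walk-zero : ∀ {v} (p : Walk G v v) → weight p ≡ 𝟎
    cycle-zero⇒closed-walk-zero p with erase-loops p
    ... | nil        , _ , eq = sym eq
    -- A nonempty closed walk lists its base both first and last, so it is not a path.
    ... | step _ _ q , d , _  =
      ⊥-elim (Unique[x∷xs]⇒x∉xs d (subst (_ ∈_) (sym (vertices-∷ʳ q)) (++⁺ʳ (initials q) (here refl))))

    weight-independent : ∀ {u v} (p q : Walk G u v) → weight p ≡ weight q
    weight-independent p q = ⊕≡𝟎⇒≡ (weight p) (weight q) (begin
      weight p ⊕ weight q             ≡⟨ cong (weight p ⊕_) (weight-reverseʷ q) ⟨
      weight p ⊕ weight (reverseʷ q)  ≡⟨ weight-++ʷ p (reverseʷ q) ⟨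
      weight (p ++ʷ reverseʷ q)       ≡⟨ cycle-zero⇒closed-walk-zero (p ++ʷ reverseʷ q) ⟩
      𝟎                               ∎)

  extend-edgeSet : (C : Cycle G) → extend h (edgeSet C) ≡ weight (Cycle.walk C)
  extend-edgeSet C = extend-indicator h (cycleEdges-unique C)

-- Labels from the root and the reduction to a cycle basis

reversePath : ∀ {G u v} → Path G u v → Path G v u
reversePath P = record
  { walk     = reverseʷ (Path.walk P)
  ; distinct = Unique-resp-↭ (↭-sym (vertices-reverseʷ (Path.walk P))) (Path.distinct P)
  }

theorem2p23 : (G : Graph) → Connected G → (r : Graph.V G) →
    (t k : ℕ) (𝒫 : Partition G t) (g : Fin t → ℤ₂^ k) →
    (WellDefined 𝒫 g r ⇔ (∀ (C : Cycle G) → ZeroOn 𝒫 g C))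
    × (∀ {d} (B : Fin d → Cycle G) → IsCycleBasis G B →
    (∀ i → ZeroOn 𝒫 g (B i)) → ∀ (C : Cycle G) → ZeroOn 𝒫 g C)
theorem2p23 G connected r t k 𝒫 g = mk⇔ cycles-zero well-defined , basis-suffices
  where
  h : Graph.E G → ℤ₂^ k
  h = g ∘ Partition.class 𝒫

  cycles-zero : WellDefined 𝒫 g r → ∀ C → ZeroOn 𝒫 g C
  cycles-zero wd C =
    closed-walk-zero h (potential-edge h (λ v → connected v r) independent) (Cycle.walk C)
    where
    -- The hypothesis `wd` compares paths that leave `r`, whereas `potential` uses paths that end
    -- there; reversal keeps the weight.
    independent : ∀ {v} (P Q : Path G v r) → weight h (Path.walk P) ≡ weight h (Path.walk Q)
    independent {v} P Q = begin
      weight h (Path.walk P)             ≡⟨ weight-reverseʷ h (Path.walk P) ⟨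
      weight h (reverseʷ (Path.walk P))  ≡⟨ wd v (reversePath P) (reversePath Q) ⟩
      weight h (reverseʷ (Path.walk Q))  ≡⟨ weight-reverseʷ h (Path.walk Q) ⟩
      weight h (Path.walk Q)             ∎

  well-defined : (∀ C → ZeroOn 𝒫 g C) → WellDefined 𝒫 g r
  well-defined zero-on v P Q = weight-independent h zero-on (Path.walk P) (Path.walk Q)

  basis-suffices : ∀ {d} (B : Fin d → Cycle G) → IsCycleBasis G B →
    (∀ i → ZeroOn 𝒫 g (B i)) → ∀ C → ZeroOn 𝒫 g C
  basis-suffices B basis zero-on C = begin
    weight h (Cycle.walk C)  ≡⟨ extend-edgeSet h C ⟨
    -- As a generator of the cycle space, `edgeSet C` lies in the span of the edge sets of `B`.
    extend h (edgeSet C)     ≡⟨ extend-span h (edgeSet ∘ B) (λ i → trans (extend-edgeSet h (B i)) (zero-on i))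
                                  (IsBasis.spanning basis (span-member edgeSet C)) ⟩
    𝟎                        ∎
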